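{- For every $h\in R$, the binary representation of $h$ does not contain $10000$ as a contiguous substring.
   Context: Stern's sequence $(a(n))_{n\ge0}$: $a(0)=0$, $a(1)=1$, $a(2n)=a(n)$, $a(2n+1)=a(n)+a(n+1)$; $s(n)=a(n+1)$ for $n\ge0$. $R$ is the set of record-setters of $s$, i.e. indices $v\ge0$ with $s(i)<s(v)$ for all $i<v$. The binary representation of a positive integer has no leading zeros; $0$ is represented by the string $0$. -}

module Defs where

open import Data.Digit using (Bit; 0b; 1b; toDigits)
open import Data.List.Base using (List; []; _∷_; reverse)
open import Data.List.Relation.Binary.Infix.Heterogeneous using (Infix)
open import Data.Nat.Base using (ℕ; zero; suc; _+_; _*_; _<_; ⌊_/2⌋; parity; s≤s; s<s)
open import Data.Nat.Induction using (Acc; acc; <-wellFounded)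
open import Data.Nat.Properties using (⌊n/2⌋≤n; ⌊n/2⌋<n; n≡⌊n+n/2⌋; +-suc; +-identityʳ)
open import Data.Parity.Base using (0ℙ; 1ℙ)
open import Data.Product.Base using (proj₁)
open import Level using (0ℓ)
open import Relation.Binary.Core using (Rel)
open import Relation.Binary.PropositionalEquality using (_≡_; refl; sym; trans; cong; cong₂)
open import Relation.Unary using (Pred)

-- For n = 2 + m we have ⌊ n /2⌋ = 1 + ⌊ m /2⌋ and n, m have the same parity.
-- The defining recurrences are a-0, a-1, a-even and a-odd below.
a-acc : ∀ n → Acc _<_ n → ℕ
a-acc 0             _        = 0
a-acc 1             _        = 1
a-acc (suc (suc m)) (acc rs) with parity m
... | 0ℙ = a-acc (1 + ⌊ m /2⌋) (rs (s<s (s≤s (⌊n/2⌋≤n m))))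
a-acc (suc (suc zero))    (acc rs) | 1ℙ = 0 -- unreachable: parity 0 = 0ℙ
a-acc (suc (suc (suc k))) (acc rs) | 1ℙ =
    a-acc (1 + ⌊ suc k /2⌋) (rs (s<s (s≤s (⌊n/2⌋≤n (suc k)))))
  + a-acc (2 + ⌊ suc k /2⌋) (rs (s<s (s<s (⌊n/2⌋<n k))))

a : ℕ → ℕ
a n = a-acc n (<-wellFounded n)

s : ℕ → ℕ
s n = a (suc n)

R : Pred ℕ 0ℓ
R v = ∀ i → i < v → s i < s v

-- Most significant digit first.  toDigits lists the least significant digit
-- first; it gives [ 0b ] for 0 and no superfluous zeros for positive numbers.
binary : ℕ → List Bit
binary n = reverse (proj₁ (toDigits 2 n))

_IsSubstringOf_ : Rel (List Bit) 0ℓ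
_IsSubstringOf_ = Infix _≡_

10000b : List Bit
10000b = 1b ∷ 0b ∷ 0b ∷ 0b ∷ 0b ∷ []

private
  a-acc-irr : ∀ n (p q : Acc _<_ n) → a-acc n p ≡ a-acc n q
  a-acc-irr 0             _ _ = refl
  a-acc-irr 1             _ _ = refl
  a-acc-irr (suc (suc m)) (acc p) (acc q) with parity m
  ... | 0ℙ = a-acc-irr (1 + ⌊ m /2⌋) _ _
  a-acc-irr (suc (suc zero))    (acc p) (acc q) | 1ℙ = refl
  a-acc-irr (suc (suc (suc k))) (acc p) (acc q) | 1ℙ =
    cong₂ _+_ (a-acc-irr (1 + ⌊ suc k /2⌋) _ _) (a-acc-irr (2 + ⌊ suc k /2⌋) (p lt) (q lt))
    where lt = s<s (s<s (⌊n/2⌋<n k))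

  a-acc-even : ∀ m p → parity m ≡ 0ℙ → a-acc (2 + m) p ≡ a (1 + ⌊ m /2⌋)
  a-acc-even m (acc p) eq with parity m
  a-acc-even m (acc p) refl | .0ℙ = a-acc-irr (1 + ⌊ m /2⌋) _ _

  a-acc-odd : ∀ k p → parity (suc k) ≡ 1ℙ →
              a-acc (3 + k) p ≡ a (1 + ⌊ suc k /2⌋) + a (2 + ⌊ suc k /2⌋)
  a-acc-odd k (acc p) eq with parity (suc k)
  a-acc-odd k (acc p) refl | .1ℙ =
    cong₂ _+_ (a-acc-irr (1 + ⌊ suc k /2⌋) _ _) (a-acc-irr (2 + ⌊ suc k /2⌋) (p (s<s (s<s (⌊n/2⌋<n k)))) _)

  parity-n+n : ∀ n → parity (n + n) ≡ 0ℙ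
  parity-n+n zero    = refl
  parity-n+n (suc n) = trans (cong (λ k → parity (suc k)) (+-suc n n)) (parity-n+n n)

  parity-1+n+n : ∀ n → parity (suc (n + n)) ≡ 1ℙ
  parity-1+n+n zero    = refl
  parity-1+n+n (suc n) =
    trans (cong (λ k → parity (suc (suc k))) (+-suc n n)) (parity-1+n+n n)

  ⌊1+n+n/2⌋ : ∀ n → ⌊ suc (n + n) /2⌋ ≡ n
  ⌊1+n+n/2⌋ zero    = refl
  ⌊1+n+n/2⌋ (suc n) =
    trans (cong (λ k → ⌊ suc (suc k) /2⌋) (+-suc n n)) (cong suc (⌊1+n+n/2⌋ n))

  2*suc : ∀ n → 2 * suc n ≡ 2 + (n + n)
  2*suc n = trans (cong (λ k → suc (n + suc k)) (+-identityʳ n)) (cong suc (+-suc n n))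

a-0 : a 0 ≡ 0
a-0 = refl

a-1 : a 1 ≡ 1
a-1 = refl

a-even : ∀ n → a (2 * n) ≡ a n
a-even zero    = refl
a-even (suc n) = trans (cong a (2*suc n))
  (trans (a-acc-even (n + n) _ (parity-n+n n))
         (cong (λ k → a (suc k)) (sym (n≡⌊n+n/2⌋ n))))

a-odd : ∀ n → a (2 * n + 1) ≡ a n + a (n + 1)
a-odd zero    = refl
a-odd (suc n) = trans (cong a eq)
  (trans (a-acc-odd (n + n) _ (parity-1+n+n n))
         (cong₂ _+_ (cong (λ k → a (suc k)) (⌊1+n+n/2⌋ n))
                    (cong a (trans (cong (2 +_) (⌊1+n+n/2⌋ n)) (sym (+1 (suc n)))))))
  where
  +1 : ∀ m → m + 1 ≡ suc m
  +1 m = trans (+-suc m 0) (cong suc (+-identityʳ m))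
  eq : 2 * suc n + 1 ≡ 3 + (n + n)
  eq = trans (+1 (2 * suc n)) (cong suc (2*suc n))

{-# OPTIONS --safe #-}

-- Reading binary digits from the most significant one, the pair (a n , a (n + 1))
-- evolves by (q , p) ↦ (q , q + p) on the digit 0 and (q , p) ↦ (q + p , p) on
-- the digit 1, and both maps are monotone.  From (q , p), the block 10000 leads to
-- (q + p , 4 q + 5 p) and the smaller block 01010 to (5 q + 3 p , 8 q + 5 p).  So
-- replacing 10000 by 01010 gives a smaller index with at least as large a value of s.

module Submission where

open import Data.Digit using (Bit; 0b; 1b; fromDigits; toDigits)
open import Data.Fin.Base using (zero; suc; toℕ)
open import Data.List.Base using (List; []; _∷_; _++_; foldr; reverse)
open import Data.List.Properties using (++-assoc; reverse-++; reverse-involutive)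
open import Data.List.Relation.Binary.Infix.Heterogeneous using (MkView; toView)
open import Data.List.Relation.Binary.Pointwise using (Pointwise-≡⇒≡)
open import Data.Nat.Base using (ℕ; suc; _+_; _*_; _≤_; _<_)
open import Data.Nat.Properties using (*-comm; *-monoˡ-<; +-comm; +-mono-≤; +-monoʳ-<; +-monoˡ-<; <-≤-trans; <-irrefl; m≤m+n)
open import Data.Nat.Tactic.RingSolver using (solve-∀)
open import Data.Product.Base using (_×_; _,_; proj₁; proj₂; ∃₂)
open import Relation.Binary.PropositionalEquality using (_≡_; refl; sym; trans; cong; cong₂; subst; subst₂; module ≡-Reasoning)
open import Relation.Nullary.Negation.Core using (¬_)
open import Relation.Unary using (_∈_)
open import Defs

a-double : ∀ n → a (n * 2) ≡ a n
a-double n = trans (cong a (*-comm n 2)) (a-even n)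

a-suc-double : ∀ n → a (suc (n * 2)) ≡ a n + a (suc n)
a-suc-double n = begin
  a (suc (n * 2))    ≡⟨ cong a (trans (cong suc (*-comm n 2)) (+-comm 1 (2 * n))) ⟩
  a (2 * n + 1)      ≡⟨ a-odd n ⟩
  a n + a (n + 1)    ≡⟨ cong (λ k → a n + a k) (+-comm n 1) ⟩
  a n + a (suc n)    ∎
  where open ≡-Reasoning

step : Bit → ℕ × ℕ → ℕ × ℕ
step zero       (q , p) = q , q + p
step (suc zero) (q , p) = q + p , p

-- The seed is `(a 0 , a 1)`; `foldr` lets the head, the least significant digit, act last.
sternPair : List Bit → ℕ × ℕ
sternPair = foldr step (0 , 1)

-- Lists of digits start with the least significant one, as for fromDigits.
sternPair-fromDigits : ∀ ds → (a (fromDigits ds) , a (suc (fromDigits ds))) ≡ sternPair ds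
sternPair-fromDigits [] = refl
sternPair-fromDigits (d ∷ ds) =
  trans (append d (fromDigits ds)) (cong (step d) (sternPair-fromDigits ds))
  where
  append : ∀ d n → (a (toℕ d + n * 2) , a (suc (toℕ d + n * 2))) ≡ step d (a n , a (suc n))
  append zero       n = cong₂ _,_ (a-double n) (a-suc-double n)
  -- `2 + n * 2` is `suc n * 2` by computation.
  append (suc zero) n = cong₂ _,_ (a-suc-double n) (a-double (suc n))

infix 4 _≼_

_≼_ : ℕ × ℕ → ℕ × ℕ → Set
(q , p) ≼ (q′ , p′) = q ≤ q′ × p ≤ p′

step-mono : ∀ d {u v} → u ≼ v → step d u ≼ step d v
step-mono zero       (q≤ , p≤) = q≤ , +-mono-≤ q≤ p≤
step-mono (suc zero) (q≤ , p≤) = +-mono-≤ q≤ p≤ , p≤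

sternPair-++-mono : ∀ xs {ys zs} → sternPair ys ≼ sternPair zs →
                    sternPair (xs ++ ys) ≼ sternPair (xs ++ zs)
sternPair-++-mono []       ys≼zs = ys≼zs
sternPair-++-mono (x ∷ xs) ys≼zs = step-mono x (sternPair-++-mono xs ys≼zs)

-- Each shared low digit only doubles the number above it and adds a constant.
fromDigits-++-mono-< : ∀ (xs : List Bit) {ys zs} → fromDigits ys < fromDigits zs →
                       fromDigits (xs ++ ys) < fromDigits (xs ++ zs)
fromDigits-++-mono-< []       ys<zs = ys<zs
fromDigits-++-mono-< (x ∷ xs) ys<zs =
  +-monoʳ-< (toℕ x) (*-monoˡ-< 2 (fromDigits-++-mono-< xs ys<zs))

01010b : List Bit
01010b = 0b ∷ 1b ∷ 0b ∷ 1b ∷ 0b ∷ []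

≤-by : ∀ {m n} k → n ≡ m + k → m ≤ n
≤-by {m} k n≡m+k = subst (m ≤_) (sym n≡m+k) (m≤m+n m k)

-- 01010b is a palindrome, so it needs no reversal.
01010-dominates-10000 : ∀ ds → sternPair (reverse 10000b ++ ds) ≼ sternPair (01010b ++ ds)
01010-dominates-10000 ds = bound (sternPair ds)
  where
  fst-eq : ∀ q p → (q + (q + p)) + ((q + (q + p)) + (q + p)) ≡ (q + p) + (4 * q + 2 * p)
  fst-eq = solve-∀
  snd-eq : ∀ q p → ((q + (q + p)) + ((q + (q + p)) + (q + p))) + ((q + (q + p)) + (q + p))
                 ≡ ((q + p) + ((q + p) + ((q + p) + ((q + p) + p)))) + 4 * q
  snd-eq = solve-∀
  bound : ∀ u → foldr step u (reverse 10000b) ≼ foldr step u 01010b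
  bound (q , p) = ≤-by (4 * q + 2 * p) (fst-eq q p) , ≤-by (4 * q) (snd-eq q p)

-- Both sides compute to a numeral plus fromDigits ds * 2 * 2 * 2 * 2 * 2.
01010<10000 : ∀ ds → fromDigits (01010b ++ ds) < fromDigits (reverse 10000b ++ ds)
01010<10000 ds = +-monoˡ-< (fromDigits ds * 2 * 2 * 2 * 2 * 2) (m≤m+n 11 5)

not-record : ∀ xs ys → ¬ (fromDigits (xs ++ reverse 10000b ++ ys) ∈ R)
not-record xs ys record-setter = <-irrefl refl (<-≤-trans s-less s-geq)
  where
  h i : ℕ
  h = fromDigits (xs ++ reverse 10000b ++ ys)
  -- For empty `ys` this list has a leading zero, which is harmless to `fromDigits`.
  i = fromDigits (xs ++ 01010b ++ ys)
  s-less : s i < s h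
  s-less = record-setter i (fromDigits-++-mono-< xs (01010<10000 ys))
  s-geq : s h ≤ s i
  -- The second components are the values of `s`; the first are carried along because `step` mixes
  -- the two.
  s-geq = proj₂ (subst₂ _≼_
    (sym (sternPair-fromDigits (xs ++ reverse 10000b ++ ys)))
    (sym (sternPair-fromDigits (xs ++ 01010b ++ ys)))
    (sternPair-++-mono xs (01010-dominates-10000 ys)))

-- Carries an occurrence in `binary h` back to the digit order of `fromDigits`; prefix and suffix
-- trade places.
infix-of-reverse : ∀ {ws} ds → ws IsSubstringOf reverse ds →
                   ∃₂ λ xs ys → ds ≡ xs ++ reverse ws ++ ys
infix-of-reverse {ws} ds sub = split refl sub
  where
  -- A variable `es` lets the view be matched, where the index `reverse ds` would not unify with a
  -- concatenation.
  split : ∀ {es} → es ≡ reverse ds → ws IsSubstringOf es →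
          ∃₂ λ xs ys → ds ≡ xs ++ reverse ws ++ ys
  split eq sub with toView sub
  ... | MkView pref ws≋inf suff with refl ← Pointwise-≡⇒≡ ws≋inf =
    reverse suff , reverse pref , (begin
      ds                                             ≡⟨ reverse-involutive ds ⟨
      reverse (reverse ds)                           ≡⟨ cong reverse eq ⟨
      reverse (pref ++ ws ++ suff)                   ≡⟨ reverse-++ pref (ws ++ suff) ⟩
      reverse (ws ++ suff) ++ reverse pref           ≡⟨ cong (_++ reverse pref) (reverse-++ ws suff) ⟩
      (reverse suff ++ reverse ws) ++ reverse pref   ≡⟨ ++-assoc (reverse suff) (reverse ws) (reverse pref) ⟩
      reverse suff ++ reverse ws ++ reverse pref     ∎)
    where open ≡-Reasoning

mainTheorem7 : ∀ (h : ℕ) → h ∈ R → ¬ (10000b IsSubstringOf binary h)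
mainTheorem7 h h∈R sub =
  let xs , ys , digits≡ = infix-of-reverse (proj₁ (toDigits 2 h)) sub
      -- `toDigits` comes with a proof that its digits evaluate to `h`.
      h≡ = trans (sym (proj₂ (toDigits 2 h))) (cong fromDigits digits≡)
  in not-record xs ys (subst R h≡ h∈R)
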